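{- For each $i<\omega$, let $k(i)\in\mathbb N$ and let $\vec a_i=\langle a_{i,0},a_{i,1},\ldots,a_{i,k(i)}\rangle$ be a compressed sequence in $\mathbb Z\setminus\{0\}$ with $a_{i,k(i)}=1$. Let $p$ be a minimal idempotent in $(\beta\mathbb N,+)$ and let $A\in p$. Then there exist sequences $\langle b_n\rangle_{n=0}^\infty$ and $\langle x_n\rangle_{n=0}^\infty$ in $\mathbb N$ such that $FS(\langle x_n\rangle_{n=0}^\infty)\subseteq A$ and, for each $i\in\omega$, $b_i+MT(\vec a_i,\langle x_n\rangle_{n=i}^\infty)\subseteq A$.
   Context: $\mathbb N=\{1,2,3,\ldots\}$, $\omega=\{0,1,2,\ldots\}$. For a set $X$, $\mathcal P_f(X)$ is the set of finite nonempty subsets of $X$. For $F,G\in\mathcal P_f(\omega)$, $F<G$ means $\max F<\min G$. A finite sequence $\langle a_0,\ldots,a_k\rangle$ of integers is compressed if no $a_i=0$ and $a_i\neq a_{i+1}$ for each $i\in\{0,1,\ldots,k-1\}$. $FS(\langle x_n\rangle_{n=0}^\infty)=\{\sum_{n\in F}x_n: F\in\mathcal P_f(\omega)\}$. For a compressed sequence $\vec a=\langle a_0,\ldots,a_k\rangle$ and $i\in\omega$, $MT(\vec a,\langle x_n\rangle_{n=i}^\infty)=\{\sum_{j=0}^k a_j\sum_{t\in F_j}x_t: F_0,F_1,\ldots,F_k\in\mathcal P_f(\{i,i+1,i+2,\ldots\})\text{ and }F_0<F_1<\cdots<F_k\}$. For $b\in\mathbb N$ and a set $X$ of integers, $b+X=\{b+x:x\in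 X\}$. $\beta\mathbb N$ is the Stone–Čech compactification of the discrete space $\mathbb N$, viewed as the set of ultrafilters on $\mathbb N$, with addition given by: $A\in p+q$ if and only if $\{x\in\mathbb N:-x+A\in q\}\in p$, where $-x+A=\{y\in\mathbb N:x+y\in A\}$. This is a compact Hausdorff right topological semigroup, having a smallest two-sided ideal $K(\beta\mathbb N)$; a minimal idempotent is an idempotent $p=p+p$ belonging to $K(\beta\mathbb N)$. -}

module Defs where

open import Algebra.Bundles using (Semigroup)
open import Algebra.Properties.Monoid.Sum using (sum)
open import Data.Fin.Base using (Fin; suc; inject₁)
open import Data.Integer.Base as ℤ using (ℤ; 0ℤ; +_)
open import Data.Integer.Properties using (+-0-monoid)
import Data.Irrelevant as Irr
import Data.List.Base as List
open import Data.List.Extrema.Nat using (max; min)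
open import Data.List.NonEmpty.Base using (List⁺; _∷_; toList; head; tail)
open import Data.List.Relation.Unary.All using (All)
open import Data.List.Relation.Unary.AllPairs using (AllPairs)
open import Data.Nat.Base as ℕ using (ℕ; suc; NonZero)
import Data.Nat.Properties as ℕ
open import Data.Product.Base using (_×_; _,_; ∃; ∃-syntax)
open import Data.Refinement using (Refinement-syntax; _,_; value; value-injective)
open import Data.Sum.Base using (_⊎_; inj₁; inj₂)
open import Function.Base using (_∘_)
open import Function.Bundles using (_⇔_; mk⇔; Equivalence)
open import Level using (Level; 0ℓ; _⊔_) renaming (suc to lsuc)
open import Relation.Binary.Definitions using (_Respects_)
open import Relation.Binary.PropositionalEquality
  using (_≡_; _≢_; refl; sym; subst)
open import Relation.Unary using (Pred; _∈_; _∉_; _⊆_; _∩_; ∁; U; ∅; Satisfiable)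

private
  variable
    ℓ : Level

-- ℕ = {1,2,3,…} is ℕ⁺; the standard library's ℕ plays the role of ω.

ℕ⁺ : Set
ℕ⁺ = [ n ∈ ℕ ∣ NonZero n ]

infixl 6 _+⁺_

_+⁺_ : ℕ⁺ → ℕ⁺ → ℕ⁺
(m , Irr.[ m≢0 ]) +⁺ (n , _) = (m ℕ.+ n) , Irr.[ +-nonZero m≢0 ]
  where
  +-nonZero : ∀ {m n} → NonZero m → NonZero (m ℕ.+ n)
  +-nonZero {suc _} _ = _

toℤ : ℕ⁺ → ℤ
toℤ n = + value n

-- A set of positive integers regarded as a set of integers.
inℤ : Pred ℕ⁺ 0ℓ → Pred ℤ 0ℓ
inℤ A z = ∃[ n ] n ∈ A × z ≡ toℤ n

record Ultrafilter (X : Set) : Set₁ where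
  field
    members  : Pred (Pred X 0ℓ) 0ℓ
    universe : U ∈ members
    proper   : ∅ ∉ members
    upward   : ∀ {A B} → A ⊆ B → A ∈ members → B ∈ members
    meet     : ∀ {A B} → A ∈ members → B ∈ members → (A ∩ B) ∈ members
    ultra    : ∀ A → A ∈ members ⊎ ∁ A ∈ members

open Ultrafilter public

βℕ : Set₁
βℕ = Ultrafilter ℕ⁺

-- Ultrafilters are sets of sets, so they are compared extensionally.
infix 4 _≈β_

_≈β_ : βℕ → βℕ → Set₁
p ≈β q = ∀ A → A ∈ members p ⇔ A ∈ members q

infixr 7 -_+ˢ_

-_+ˢ_ : ℕ⁺ → Pred ℕ⁺ 0ℓ → Pred ℕ⁺ 0ℓ
(- x +ˢ A) y = x +⁺ y ∈ A

infixl 6 _+β_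

_+β_ : βℕ → βℕ → βℕ
members  (p +β q) A = (λ x → - x +ˢ A ∈ members q) ∈ members p
universe (p +β q) = upward p (λ _ → universe q) (universe p)
proper   (p +β q) h = proper p (upward p (proper q) h)
upward   (p +β q) A⊆B = upward p (upward q A⊆B)
meet     (p +β q) hA hB =
  upward p (λ (a , b) → meet q a b) (meet p hA hB)
ultra    (p +β q) A with ultra p (λ x → - x +ˢ A ∈ members q)
... | inj₁ h = inj₁ h
... | inj₂ h = inj₂ (upward p (λ {x} → qCompl {x}) h)
  where
  qCompl : ∁ (λ x → - x +ˢ A ∈ members q) ⊆ (λ x → - x +ˢ ∁ A ∈ members q)
  qCompl {x} ¬qA with ultra q (- x +ˢ A)
  ... | inj₁ qA  with () ← ¬qA qA
  ... | inj₂ qAᶜ = qAᶜ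

+⁺-assoc : ∀ x y z → (x +⁺ y) +⁺ z ≡ x +⁺ (y +⁺ z)
+⁺-assoc x y z = value-injective (ℕ.+-assoc (value x) (value y) (value z))

βℕ-semigroup : Semigroup (lsuc 0ℓ) (lsuc 0ℓ)
βℕ-semigroup = record
  { Carrier = βℕ
  ; _≈_     = _≈β_
  ; _∙_     = _+β_
  ; isSemigroup = record
    { isMagma = record
      { isEquivalence = record
        { refl  = λ A → mk⇔ (λ h → h) (λ h → h)
        ; sym   = λ e A → mk⇔ (from (e A)) (to (e A))
        ; trans = λ e f A → mk⇔ (to (f A) ∘ to (e A)) (from (e A) ∘ from (f A))
        }
      ; ∙-cong = λ {p} {p′} {q} {q′} e f A → mk⇔
          (λ h → to   (e _) (upward p  (λ {x} → to   (f (- x +ˢ A))) h))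
          (λ h → from (e _) (upward p′ (λ {x} → from (f (- x +ˢ A))) h))
      }
    ; assoc = λ p q r A → mk⇔
        (upward p (λ {x} → upward q (λ {y} → upward r (λ {z} →
          subst A (+⁺-assoc x y z)))))
        (upward p (λ {x} → upward q (λ {y} → upward r (λ {z} →
          subst A (sym (+⁺-assoc x y z))))))
    }
  }
  where open Equivalence using (to; from)

module _ {c e} (S : Semigroup c e) where
  open Semigroup S

  record IsIdeal (I : Pred Carrier ℓ) : Set (c ⊔ e ⊔ ℓ) where
    field
      respects : I Respects _≈_
      nonempty : Satisfiable I
      absorbsˡ : ∀ s {x} → x ∈ I → s ∙ x ∈ I
      absorbsʳ : ∀ s {x} → x ∈ I → x ∙ s ∈ I

  record IsSmallestIdeal (K : Pred Carrier ℓ) : Set (c ⊔ e ⊔ lsuc ℓ) where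
    field
      isIdeal : IsIdeal K
      least   : ∀ (I : Pred Carrier ℓ) → IsIdeal I → K ⊆ I

-- Membership in K(βℕ) is membership in an ideal that is the smallest one.
record IsMinimalIdempotent (p : βℕ) : Set₂ where
  field
    idempotent : p +β p ≈β p
    K          : Pred βℕ (lsuc 0ℓ)
    K-smallest : IsSmallestIdeal βℕ-semigroup K
    p∈K        : p ∈ K

-- Finite nonempty subsets of ω, each represented by its strictly
-- increasing enumeration

record 𝒫f : Set where
  field
    elements   : List⁺ ℕ
    increasing : AllPairs ℕ._<_ (toList elements)

open 𝒫f public

max𝒫f min𝒫f : 𝒫f → ℕ
max𝒫f F = max (head (elements F)) (tail (elements F))
min𝒫f F = min (head (elements F)) (tail (elements F))

infix 4 _<𝒫f_

_<𝒫f_ : 𝒫f → 𝒫f → Set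
F <𝒫f G = max𝒫f F ℕ.< min𝒫f G

∑∈ : 𝒫f → (ℕ → ℤ) → ℤ
∑∈ F f = List.foldr ℤ._+_ 0ℤ (List.map f (toList (elements F)))

-- Milliken–Taylor sums may be negative, so these are sets of integers.
FS : (ℕ → ℕ⁺) → Pred ℤ 0ℓ
FS x z = ∃[ F ] z ≡ ∑∈ F (toℤ ∘ x)

record Compressed {k : ℕ} (a : Fin (suc k) → ℤ) : Set where
  field
    nonzero  : ∀ j → a j ≢ 0ℤ
    adjacent : ∀ (j : Fin k) → a (inject₁ j) ≢ a (suc j)

-- MT a i x is MT(a, ⟨xₙ⟩ₙ₌ᵢ^∞): the sequence x is indexed from 0, and i
-- bounds the indices used from below.
MT : {k : ℕ} → (Fin (suc k) → ℤ) → ℕ → (ℕ → ℕ⁺) → Pred ℤ 0ℓ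
MT {k} a i x z = ∃ λ (F : Fin (suc k) → 𝒫f) →
    (∀ j → All (i ℕ.≤_) (toList (elements (F j))))
  × (∀ (j : Fin k) → F (inject₁ j) <𝒫f F (suc j))
  × z ≡ sum +-0-monoid (λ (j : Fin (suc k)) → a j ℤ.* ∑∈ (F j) (toℤ ∘ x))

infixr 6 _+ᵗ_

_+ᵗ_ : ℕ⁺ → Pred ℤ 0ℓ → Pred ℤ 0ℓ
(b +ᵗ X) z = ∃[ y ] y ∈ X × z ≡ toℤ b ℤ.+ y

{-# OPTIONS --safe #-}
module Submission where

-- For a minimal idempotent p and A ∈ p, the set {x : -x + A ∈ p} is syndetic, and p = p + p extends
-- this from ℕ to ℤ: finitely many translates cover ℤ.  Pigeonholing them in the ultrafilter
-- q = c₀p + ⋯ + cₖ₋₁p on ℤ yields b with A ∈ b + q + p.  Hence every system MT(aᵢ) starts with an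
-- iterated p-limit condition (FS being the system of ⟨1⟩).  Each xₙ is then chosen to preserve, as in
-- Galvin's proof of Hindman's theorem, the finitely many conditions pending at stage n: since
-- p = p + p, p-almost every term may both close and prolong a block.
--
-- Excluded middle decides arbitrary types, so it acts as a global choice operator; this makes Zorn-type
-- arguments available.

open import Defs
import Algebra.Properties.CommutativeSemigroup as CommutativeSemigroupProperties
open import Algebra.Properties.Monoid.Sum using (sum)
open import Axiom.ExcludedMiddle using (ExcludedMiddle)
open import Axiom.Extensionality.Propositional using (Extensionality)
open import Data.Bool.Base using (Bool; true; false)
open import Data.Empty using (⊥; ⊥-elim)
open import Data.Fin.Base as Fin using (Fin; fromℕ)
open import Data.Integer.Base as ℤ using (ℤ; 0ℤ; 1ℤ; +_; -[1+_])
import Data.Integer.Properties as ℤ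
open import Data.Integer.Properties using (+-0-monoid)
open import Data.Integer.Tactic.RingSolver using () renaming (solve-∀ to ℤ-solve-∀)
import Data.Irrelevant as Irr
open import Data.List.Base as List using (List; []; _∷_; _++_; foldr)
open import Data.List.Extrema.Nat using (⊥≤max; xs≤max; min≤⊤; min≤xs)
open import Data.List.Membership.Propositional using () renaming (_∈_ to _∈ˡ_)
open import Data.List.Membership.Propositional.Properties using (∈-++⁺ˡ; ∈-++⁺ʳ; ∈-concatMap⁺)
open import Data.List.NonEmpty.Base using (_∷_; toList)
open import Data.List.Relation.Binary.Subset.Propositional using () renaming (_⊆_ to _⊆ˡ_)
import Data.List.Relation.Binary.Subset.Propositional.Properties as ⊆ˡ
open import Data.List.Relation.Unary.All as All using (All; []; _∷_)
import Data.List.Relation.Unary.All.Properties as All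
open import Data.List.Relation.Unary.All.Properties.Core using (¬Any⇒All¬)
open import Data.List.Relation.Unary.AllPairs using (AllPairs; _∷_)
open import Data.List.Relation.Unary.Any as Any using (Any; here; there)
import Data.List.Relation.Unary.Any.Properties as Any
open import Data.Nat.Base as ℕ using (ℕ; suc)
import Data.Nat.Properties as ℕ
open import Data.Nat.Tactic.RingSolver using (solve-∀)
open import Data.Product.Base using (_×_; _,_; ∃; proj₁; proj₂)
open import Data.Refinement using (_,_; value; value-injective)
open import Data.Sum.Base using (_⊎_; inj₁; inj₂)
open import Function.Base using (_∘_; id)
open import Function.Bundles using (Equivalence)
open import Level using (Level; Lift; 0ℓ) renaming (suc to lsuc)
open import Relation.Binary.PropositionalEquality using (_≡_; refl; sym; trans; cong; subst)
open import Relation.Nullary using (¬_; Dec; yes; no; does)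
open import Relation.Nullary.Decidable using (decidable-stable)
open import Relation.Unary using (Pred; _∈_; _⊆_; _∩_; ∁; U; Satisfiable)

open CommutativeSemigroupProperties ℕ.+-commutativeSemigroup using (x∙yz≈y∙xz; xy∙z≈xz∙y)
open CommutativeSemigroupProperties ℤ.+-commutativeSemigroup using ()
  renaming (xy∙z≈xz∙y to xy∙z≈xz∙y-ℤ)

private
  variable
    ℓ ℓ′ : Level

distrib : ∀ m c x y → m ℤ.+ c ℤ.* (x ℤ.+ y) ≡ (m ℤ.+ c ℤ.* x) ℤ.+ c ℤ.* y
distrib = ℤ-solve-∀

-- Tukey's lemma by transfinite iteration.

module Tukey
  (em : ∀ {ℓ} → ExcludedMiddle ℓ) (ext : ∀ {ℓ ℓ′} → Extensionality ℓ ℓ′)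
  {X : Set ℓ} (Con : Pred (List X) ℓ′) (Con-[] : Con [])
  (Con-⊆ : ∀ {xs ys} → xs ⊆ˡ ys → Con ys → Con xs)
  where

  -- `Bool`-valued so that subsets stay at level `ℓ`; excluded middle turns a predicate of any level
  -- into one.
  Subset : Set ℓ
  Subset = X → Bool

  ⟨_⟩ : Subset → Pred X 0ℓ
  ⟨ S ⟩ x = S x ≡ true

  ⌊_⌋ : ∀ {c} → Pred X c → Subset
  ⌊ P ⌋ x = does (em {P = P x})

  ⌊⌋-sound : ∀ {c} (P : Pred X c) → ⟨ ⌊ P ⌋ ⟩ ⊆ P
  ⌊⌋-sound P {x} with em {P = P x}
  ... | yes px = λ _ → px
  ... | no _ = λ ()

  ⌊⌋-complete : ∀ {c} (P : Pred X c) → P ⊆ ⟨ ⌊ P ⌋ ⟩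
  ⌊⌋-complete P {x} px with em {P = P x}
  ... | yes _ = refl
  ... | no ¬px = ⊥-elim (¬px px)

  ⊆-antisym : ∀ {S T} → ⟨ S ⟩ ⊆ ⟨ T ⟩ → ⟨ T ⟩ ⊆ ⟨ S ⟩ → S ≡ T
  ⊆-antisym {S} {T} S⊆T T⊆S = ext λ x → same (S⊆T {x}) (T⊆S {x})
    where
    same : ∀ {a b} → (a ≡ true → b ≡ true) → (b ≡ true → a ≡ true) → a ≡ b
    same {true} f _ = sym (f refl)
    same {false} {true} _ g = g refl
    same {false} {false} _ _ = refl

  Consistent : Subset → Set _
  Consistent S = ∀ {xs} → All ⟨ S ⟩ xs → Con xs

  Addable : Subset → Pred X _
  Addable S x = ∀ {xs} → All ⟨ S ⟩ xs → Con (x ∷ xs)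

  New : Subset → Set _
  New S = ∃ λ x → ¬ ⟨ S ⟩ x × Addable S x

  chosen : ∀ {S} → Dec (New S) → Pred X ℓ
  chosen (yes (y , _)) x = x ≡ y
  chosen {S} (no _) x = Lift ℓ ⊥

  Extended : Subset → Pred X _
  Extended S x = ⟨ S ⟩ x ⊎ chosen (em {P = New S}) x

  extend : Subset → Subset
  extend S = ⌊ Extended S ⌋

  -- A surrogate for the ordinals of a transfinite iteration.
  data Stage : Set (lsuc ℓ) where
    next : Stage → Stage
    sup  : {I : Set ℓ} → (I → Stage) → Stage

  ⟦_⟧ : Stage → Subset
  Union : {I : Set ℓ} → (I → Stage) → Pred X ℓ

  ⟦ next s ⟧ = extend ⟦ s ⟧
  ⟦ sup f ⟧  = ⌊ Union f ⌋

  Union f x = ∃ λ i → ⟨ ⟦ f i ⟧ ⟩ x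

  infix 4 _≤_
  _≤_ : Stage → Stage → Set _
  s ≤ t = ⟨ ⟦ s ⟧ ⟩ ⊆ ⟨ ⟦ t ⟧ ⟩

  ≤-next : ∀ s → s ≤ next s
  ≤-next s h = ⌊⌋-complete (Extended ⟦ s ⟧) (inj₁ h)

  ≤-sup : ∀ {I : Set ℓ} (f : I → Stage) i → f i ≤ sup f
  ≤-sup f i h = ⌊⌋-complete (Union f) (i , h)

  sup-≤ : ∀ {I : Set ℓ} (f : I → Stage) {t} → (∀ i → f i ≤ t) → sup f ≤ t
  sup-≤ f h k with i , k′ ← ⌊⌋-sound (Union f) k = h i k′

  -- `extend` depends on the subset alone, and mutually included subsets are equal by
  -- extensionality. A single inclusion would not do, since `extend` need not be monotone.
  next-cong : ∀ {s t} → s ≤ t → t ≤ s → next s ≤ next t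
  next-cong s≤t t≤s {x} = subst (λ S → ⟨ extend S ⟩ x) (⊆-antisym s≤t t≤s)

  -- The comparability argument is that of the Bourbaki–Witt theorem.
  Extreme : Stage → Set _
  Extreme t = ∀ s → s ≤ t → t ≤ s ⊎ next s ≤ t

  all≤⊎∃≰ : ∀ {I : Set ℓ} (f : I → Stage) t → (∀ i → f i ≤ t) ⊎ ∃ λ i → ¬ f i ≤ t
  all≤⊎∃≰ f t with em {P = ∃ λ i → ¬ f i ≤ t}
  ... | yes h = inj₂ h
  ... | no ¬h = inj₁ λ i → decidable-stable (em {P = f i ≤ t}) λ ≰ → ¬h (i , λ k → ≰ k)

  extreme-comparable : ∀ t → Extreme t → ∀ s → s ≤ t ⊎ next t ≤ s
  extreme-comparable t e (next s) with extreme-comparable t e s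
  ... | inj₂ h = inj₂ (λ x → ≤-next s (h x))
  ... | inj₁ s≤t with e s s≤t
  ...   | inj₁ t≤s = inj₂ (next-cong {t} {s} t≤s s≤t)
  ...   | inj₂ h   = inj₁ h
  extreme-comparable t e (sup f) with all≤⊎∃≰ f t
  ... | inj₁ h = inj₁ (sup-≤ f {t} h)
  ... | inj₂ (i , ≰) with extreme-comparable t e (f i)
  ...   | inj₁ h = ⊥-elim (≰ h)
  ...   | inj₂ h = inj₂ (λ x → ≤-sup f i (h x))

  extreme : ∀ t → Extreme t
  extreme (next t) s s≤ with extreme-comparable t (extreme t) s
  ... | inj₂ h = inj₁ h
  ... | inj₁ s≤t with extreme t s s≤t
  ...   | inj₁ t≤s = inj₂ (next-cong {s} {t} s≤t t≤s)
  ...   | inj₂ h   = inj₂ (λ x → ≤-next t (h x))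
  extreme (sup f) s s≤ with all≤⊎∃≰ f s
  ... | inj₁ h = inj₁ (sup-≤ f {s} h)
  ... | inj₂ (i , ≰) with extreme-comparable (f i) (extreme (f i)) s
  ...   | inj₂ h = ⊥-elim (≰ (λ x → h (≤-next (f i) x)))
  ...   | inj₁ s≤fi with extreme (f i) s s≤fi
  ...     | inj₁ h = ⊥-elim (≰ h)
  ...     | inj₂ h = inj₂ (λ x → ≤-sup f i (h x))

  ≤-total : ∀ s t → s ≤ t ⊎ t ≤ s
  ≤-total s t with extreme-comparable t (extreme t) s
  ... | inj₁ h = inj₁ h
  ... | inj₂ h = inj₂ (λ x → h (≤-next t x))

  -- Stages are linearly ordered, so one of the finitely many witnessing indices dominates. The list
  -- is nonempty because `I` may be empty.
  finite⊆sup : ∀ {I : Set ℓ} (f : I → Stage) {x xs} → All ⟨ ⟦ sup f ⟧ ⟩ (x ∷ xs) →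
               ∃ λ i → All ⟨ ⟦ f i ⟧ ⟩ (x ∷ xs)
  finite⊆sup f (h ∷ []) with i , h′ ← ⌊⌋-sound (Union f) h = i , h′ ∷ []
  finite⊆sup f (h ∷ hs@(_ ∷ _))
    with i , h′ ← ⌊⌋-sound (Union f) h | j , hs′ ← finite⊆sup f hs
    with ≤-total (f i) (f j)
  ... | inj₁ i≤j = j , i≤j h′ ∷ hs′
  ... | inj₂ j≤i = i , h′ ∷ All.map j≤i hs′

  -- `x` may recur in the list, whereas `Addable` supplies it once: `reduce` drops its copies, and
  -- `Con-⊆` ignores order and repetition.
  addable-consistent : ∀ {S} {P : Pred X 0ℓ} {x} → Addable S x →
    (∀ {y} → P y → ⟨ S ⟩ y ⊎ y ≡ x) → ∀ {xs} → All P xs → Con xs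
  addable-consistent {S} {P} {x} addable P⊆S∪x {xs} ps =
    let ys , ys⊆S , xs⊆ = reduce ps in Con-⊆ xs⊆ (addable ys⊆S)
    where
    reduce : ∀ {xs} → All P xs → ∃ λ ys → All ⟨ S ⟩ ys × xs ⊆ˡ x ∷ ys
    reduce [] = [] , [] , λ ()
    reduce (p ∷ ps) with ys , ys⊆S , ⊆ys ← reduce ps | P⊆S∪x p
    ... | inj₂ refl = ys , ys⊆S , λ { (here e) → here e ; (there k) → ⊆ys k }
    ... | inj₁ y∈S  = _ ∷ ys , y∈S ∷ ys⊆S ,
      λ { (here e) → there (here e) ; (there k) → ∷-mono (⊆ys k) }
      where
      ∷-mono = ⊆ˡ.∷⁺ʳ x (⊆ˡ.xs⊆x∷xs ys _)

  stage-consistent : ∀ s → Consistent ⟦ s ⟧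
  stage-consistent (next s) = go em (⌊⌋-sound (Extended ⟦ s ⟧))
    where
    go : (d : Dec (New ⟦ s ⟧)) → (∀ {y} → ⟨ extend ⟦ s ⟧ ⟩ y → ⟨ ⟦ s ⟧ ⟩ y ⊎ chosen d y) →
         Consistent (extend ⟦ s ⟧)
    go (yes (x , _ , addable)) sound = addable-consistent addable sound
    go (no _) sound hs = stage-consistent s (All.map (λ h → old (sound h)) hs)
      where
      old : ∀ {y} → ⟨ ⟦ s ⟧ ⟩ y ⊎ Lift ℓ ⊥ → ⟨ ⟦ s ⟧ ⟩ y
      old (inj₁ h) = h
  stage-consistent (sup f) {[]} _ = Con-[]
  stage-consistent (sup f) {_ ∷ _} hs with i , hs′ ← finite⊆sup f hs = stage-consistent (f i) hs′

  Reached : Pred X (lsuc ℓ)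
  Reached x = ∃ λ s → ⟨ ⟦ s ⟧ ⟩ x

  -- Resizing through Bool makes the union of all stages a union over a small index type.
  reachedAt : ∃ ⟨ ⌊ Reached ⌋ ⟩ → Stage
  reachedAt (_ , h) = proj₁ (⌊⌋-sound Reached h)

  last : Stage
  last = sup reachedAt

  ≤-last : ∀ s → s ≤ last
  ≤-last s {x} h = ≤-sup reachedAt (x , r) (proj₂ (⌊⌋-sound Reached r))
    where
    r : ⟨ ⌊ Reached ⌋ ⟩ x
    r = ⌊⌋-complete Reached (s , h)

  -- An addable `x` outside `last` would make `next last` gain some new `y`, perhaps other than `x`;
  -- but `next last ≤ last`.
  last-maximal : Addable ⟦ last ⟧ ⊆ ⟨ ⟦ last ⟧ ⟩
  last-maximal {x} addable with em {P = ⟨ ⟦ last ⟧ ⟩ x}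
  ... | yes h = h
  ... | no ¬h = ⊥-elim (go em λ k → ≤-last (next last) (⌊⌋-complete (Extended ⟦ last ⟧) (inj₂ k)))
    where
    go : (d : Dec (New ⟦ last ⟧)) → ¬ (∀ {y} → chosen d y → ⟨ ⟦ last ⟧ ⟩ y)
    go (yes (y , y∉ , _)) h = y∉ (h refl)
    go (no none) _ = none (x , ¬h , addable)

  maximal : ∃ λ S → Consistent S × Addable S ⊆ ⟨ S ⟩
  maximal = ⟦ last ⟧ , stage-consistent last , last-maximal

-- Finite intersections, thick and syndetic sets, pigeonhole in ultrafilters.

⋂ : ∀ {X : Set} → List (Pred X 0ℓ) → Pred X 0ℓ
⋂ = foldr _∩_ U

⋂-++ : ∀ {X : Set} (As : List (Pred X 0ℓ)) {Bs} → ⋂ (As ++ Bs) ⊆ ⋂ As ∩ ⋂ Bs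
⋂-++ []       h       = _ , h
⋂-++ (A ∷ As) (a , h) = let as , bs = ⋂-++ As h in (a , as) , bs

∈⇒⋂⊆ : ∀ {X : Set} {A : Pred X 0ℓ} {As} → A ∈ˡ As → ⋂ As ⊆ A
∈⇒⋂⊆ (here refl) (a , _)  = a
∈⇒⋂⊆ (there A∈)  (_ , as) = ∈⇒⋂⊆ A∈ as

⋂-antitone : ∀ {X : Set} {As Bs : List (Pred X 0ℓ)} → As ⊆ˡ Bs → ⋂ Bs ⊆ ⋂ As
⋂-antitone {As = []}    _   _ = _
⋂-antitone {As = _ ∷ _} sub h = ∈⇒⋂⊆ (sub (here refl)) h , ⋂-antitone (sub ∘ there) h

Thick Syndetic : Pred (Pred ℕ⁺ 0ℓ) 0ℓ
Thick    A = ∀ G → ∃ λ x → All (λ g → x +⁺ g ∈ A) G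
Syndetic A = ∃ λ G → ∀ x → Any (λ g → x +⁺ g ∈ A) G

x+yz≡y+xz : ∀ x y z → x +⁺ (y +⁺ z) ≡ y +⁺ (x +⁺ z)
x+yz≡y+xz x y z = value-injective (x∙yz≈y∙xz (value x) (value y) (value z))

xy+z≡xz+y : ∀ x y z → (x +⁺ y) +⁺ z ≡ (x +⁺ z) +⁺ y
xy+z≡xz+y x y z = value-injective (xy∙z≈xz∙y (value x) (value y) (value z))

1⁺ : ℕ⁺
1⁺ = 1 , Irr.[ _ ]

Thick⇒Satisfiable : ∀ {A} → Thick A → Satisfiable A
Thick⇒Satisfiable thick with x , (h ∷ []) ← thick (1⁺ ∷ []) = x +⁺ 1⁺ , h

-- Combinatorial form of "p lies in a minimal left ideal".
UniformlyRecurrent : Pred βℕ (lsuc 0ℓ)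
UniformlyRecurrent p = ∀ A → A ∈ members p → Syndetic (λ x → - x +ˢ A ∈ members p)

module _ {X : Set} (p : Ultrafilter X) where

  pigeonhole : ∀ {I : Set} {P : I → Pred X 0ℓ} G →
    (λ x → Any (λ g → x ∈ P g) G) ∈ members p → Any (λ g → P g ∈ members p) G
  pigeonhole []      h = ⊥-elim (proper p (upward p (λ ()) h))
  pigeonhole {P = P} (g ∷ G) h with ultra p (P g)
  ... | inj₁ k = here k
  ... | inj₂ k = there (pigeonhole G (upward p drop (meet p k h)))
    where
    drop : ∁ (P g) ∩ (λ x → Any (λ g → x ∈ P g) (g ∷ G)) ⊆ (λ x → Any (λ g → x ∈ P g) G)
    drop (¬k , here k)  = ⊥-elim (¬k k)
    drop (_  , there h) = h

  finite-meet : ∀ {I : Set} {P : I → Pred X 0ℓ} {G} →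
    All (λ g → P g ∈ members p) G → (λ x → All (λ g → x ∈ P g) G) ∈ members p
  finite-meet []       = upward p (λ _ → []) (universe p)
  finite-meet (h ∷ hs) = upward p (λ (k , ks) → k ∷ ks) (meet p h (finite-meet hs))

-- Uniform recurrence of the points of the smallest ideal.

module _ (em : ∀ {ℓ} → ExcludedMiddle ℓ) where

  by-contradiction : ∀ {P : Set ℓ} → ¬ ¬ P → P
  by-contradiction = decidable-stable em

  member⇒Satisfiable : ∀ {X} (p : Ultrafilter X) {A} → A ∈ members p → Satisfiable A
  member⇒Satisfiable p A∈p =
    by-contradiction λ ¬sat → proper p (upward p (λ x∈A → ¬sat (_ , x∈A)) A∈p)

  ¬Thick∁⇒Syndetic : ∀ {A} → ¬ Thick (∁ A) → Syndetic A
  ¬Thick∁⇒Syndetic {A} ¬thick = by-contradiction λ ¬syn → ¬thick λ G →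
    by-contradiction λ none → ¬syn (G , λ x → by-contradiction λ ¬any → none (x , ¬Any⇒All¬ G ¬any))

  -- As an ideal it contains the smallest one, so minimal idempotents are uniformly recurrent.
  uniformlyRecurrent-isIdeal : Satisfiable UniformlyRecurrent →
                               IsIdeal βℕ-semigroup UniformlyRecurrent
  uniformlyRecurrent-isIdeal sat = record
    { respects = λ e ur A A∈q →
        let G , h = ur A (from (e A) A∈q) in
        G , λ x → Any.map (to (e _)) (h x)
    ; nonempty = sat
    ; absorbsˡ = absorbsˡ
    ; absorbsʳ = absorbsʳ
    }
    where
    open Equivalence

    absorbsʳ : ∀ s {q} → UniformlyRecurrent q → UniformlyRecurrent (q +β s)
    absorbsʳ s {q} ur A A∈ = let G , h = ur _ A∈ in
      G , λ y → Any.map (λ {g} → upward q λ {x} → upward s λ {z} →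
        subst A (+⁺-assoc (y +⁺ g) x z)) (h y)

    -- The `g` found for `y +⁺ x` may vary with `x`; as `G` is finite, one `g` serves `s`-almost
    -- every `x`. Fixing `x₀` with `- x₀ +ˢ A` in `q`, the shifts for `s +β q` are the `x₀ +⁺ g`.
    absorbsˡ : ∀ s {q} → UniformlyRecurrent q → UniformlyRecurrent (s +β q)
    absorbsˡ s {q} ur A A∈ =
      let x₀ , x₀∈ = member⇒Satisfiable s A∈
          G , h    = ur (- x₀ +ˢ A) x₀∈
      in List.map (x₀ +⁺_) G , λ y → Any.map⁺ (pigeonhole s G (upward s
           (λ {x} _ → Any.map (λ {g} → upward q (λ {z} → subst A (rearrange x₀ y x g z))) (h (y +⁺ x)))
           (universe s)))
      where
      rearrange : ∀ x₀ y x g z →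
        x₀ +⁺ (((y +⁺ x) +⁺ g) +⁺ z) ≡ (y +⁺ (x₀ +⁺ g)) +⁺ (x +⁺ z)
      rearrange x₀ y x g z = value-injective (lemma (value x₀) (value y) (value x) (value g) (value z))
        where
        lemma : ∀ x₀ y x g z → x₀ ℕ.+ (((y ℕ.+ x) ℕ.+ g) ℕ.+ z) ≡ (y ℕ.+ (x₀ ℕ.+ g)) ℕ.+ (x ℕ.+ z)
        lemma = solve-∀

  module _ (ext : ∀ {ℓ ℓ′} → Extensionality ℓ ℓ′) where

    -- Consistency is taken relative to `S`: finite intersections must meet those from `S`. Each set
    -- in `S` is then addable, so maximality puts it in `M`.
    extendToUltrafilter : ∀ {X : Set} (S : Pred (Pred X 0ℓ) ℓ) →
      (∀ {As} → All S As → Satisfiable (⋂ As)) → ∃ λ q → S ⊆ members q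
    extendToUltrafilter {X = X} S S-fip = q , λ A∈S → M-maximal λ Cs∈M Bs∈S →
        let x , (cs , b , bs) = M-consistent Cs∈M (A∈S ∷ Bs∈S) in x , ((b , cs) , bs)
      where
      Meets-S : Pred (List (Pred X 0ℓ)) _
      Meets-S As = ∀ {Bs} → All S Bs → Satisfiable (⋂ As ∩ ⋂ Bs)

      Meets-S-[] : Meets-S []
      Meets-S-[] Bs∈S = let x , h = S-fip Bs∈S in x , (_ , h)

      Meets-S-⊆ : ∀ {As Cs} → As ⊆ˡ Cs → Meets-S Cs → Meets-S As
      Meets-S-⊆ sub c Bs∈S = let x , (h , k) = c Bs∈S in x , (⋂-antitone sub h , k)

      open Tukey em ext Meets-S Meets-S-[] Meets-S-⊆ using (⟨_⟩; Addable; Consistent; maximal)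

      M = proj₁ maximal

      M-consistent : Consistent M
      M-consistent = proj₁ (proj₂ maximal)

      M-maximal : Addable M ⊆ ⟨ M ⟩
      M-maximal = proj₂ (proj₂ maximal)

      complement : ∀ {A} → ¬ ⟨ M ⟩ A → ⟨ M ⟩ (∁ A)
      -- If `∁ A` is not addable, some finite intersection from `M` and `S` lies inside `A`, which
      -- makes `A` addable.
      complement {A} A∉M = M-maximal λ {Cs} Cs∈M {Bs} Bs∈S → by-contradiction λ none →
        A∉M (M-maximal λ Cs′∈M Bs′∈S →
          let x , (cs , bs) = M-consistent (All.++⁺ Cs∈M Cs′∈M) (All.++⁺ Bs∈S Bs′∈S)
              c , c′ = ⋂-++ Cs cs
              b , b′ = ⋂-++ Bs bs
          in x , ((by-contradiction (λ x∉A → none (x , ((x∉A , c) , b))) , c′) , b′))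

      q : Ultrafilter X
      q .members    = ⟨ M ⟩
      q .universe   = M-maximal λ Cs∈M Bs∈S →
        let x , (cs , bs) = M-consistent Cs∈M Bs∈S in x , ((_ , cs) , bs)
      q .proper ∅∈M with () ← proj₁ (proj₁ (proj₂ (M-consistent (∅∈M ∷ []) [])))
      q .upward A⊆B A∈M = M-maximal λ Cs∈M Bs∈S →
        let x , ((a , cs) , bs) = M-consistent (A∈M ∷ Cs∈M) Bs∈S in x , ((A⊆B a , cs) , bs)
      q .meet A∈M B∈M = M-maximal λ Cs∈M Bs∈S →
        let x , ((a , b , cs) , bs) = M-consistent (A∈M ∷ B∈M ∷ Cs∈M) Bs∈S in x , (((a , b) , cs) , bs)
      q .ultra A with em {P = ⟨ M ⟩ A}
      ... | yes A∈M = inj₁ A∈M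
      ... | no  A∉M = inj₂ (complement A∉M)

    -- Families of sets all of whose finite intersections are thick correspond to closed left
    -- ideals of βℕ, so a maximal family is a minimal left ideal, and q is any point of it.
    uniformlyRecurrent-exists : Satisfiable UniformlyRecurrent
    uniformlyRecurrent-exists = q , λ A A∈q → ¬Thick∁⇒Syndetic {λ x → - x +ˢ A ∈ members q} λ thick →
        proper q (upward q (λ (x∉A , x∈A) → x∉A x∈A)
          (meet q (M⊆q {∁ A} (∁-member A thick)) A∈q))
      where
      Thick-⋂[] : Thick (⋂ [])
      Thick-⋂[] G = 1⁺ , All.universal _ G

      Thick-⋂-⊆ : ∀ {As Bs} → As ⊆ˡ Bs → Thick (⋂ Bs) → Thick (⋂ As)
      Thick-⋂-⊆ sub thick G = let x , h = thick G in x , All.map (⋂-antitone sub) h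

      open Tukey em ext (Thick ∘ ⋂) Thick-⋂[] Thick-⋂-⊆ using (⟨_⟩; Addable; Consistent; maximal)

      M = proj₁ maximal

      M-consistent : Consistent M
      M-consistent = proj₁ (proj₂ maximal)

      M-maximal : Addable M ⊆ ⟨ M ⟩
      M-maximal = proj₂ (proj₂ maximal)

      -- Translation invariance makes the closed set given by `M` a left ideal. Consistency is
      -- applied to `G` together with its translate by `x`.
      shift : ∀ x {A} → ⟨ M ⟩ A → ⟨ M ⟩ (- x +ˢ A)
      shift x {A} A∈M = M-maximal λ Bs∈M G →
        let y , h   = M-consistent (A∈M ∷ Bs∈M) (G ++ List.map (x +⁺_) G)
            hs , ks = All.++⁻ G h
        in y , All.zipWith (λ {g} ((_ , b) , (a , _)) → subst A (x+yz≡y+xz y x g) a , b)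
                           (hs , All.map⁻ ks)

      extension = extendToUltrafilter ⟨ M ⟩ λ As∈M → Thick⇒Satisfiable (M-consistent As∈M)

      q = proj₁ extension

      M⊆q : ⟨ M ⟩ ⊆ members q
      M⊆q = proj₂ extension

      shift-⋂ : ∀ x {As} → All ⟨ M ⟩ As → - x +ˢ ⋂ As ∈ members q
      shift-⋂ x []            = universe q
      shift-⋂ x {A ∷ _} (A∈M ∷ As∈M) = meet q (M⊆q (shift x {A} A∈M)) (shift-⋂ x As∈M)

      shift-∁ : ∀ x {A} → ¬ (- x +ˢ A ∈ members q) → - x +ˢ ∁ A ∈ members q
      shift-∁ x {A} ∉q with ultra q (- x +ˢ A)
      ... | inj₁ ∈q = ⊥-elim (∉q ∈q)
      ... | inj₂ h  = h

      -- Thickness gives `x` such that the shifts of `∁ A` by all `x +⁺ g` lie in `q`. So do those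
      -- of `⋂ Bs`, by invariance of `M`; a common point `y` yields the translate `x +⁺ y`.
      ∁-member : ∀ A → Thick (∁ (λ x → - x +ˢ A ∈ members q)) → ⟨ M ⟩ (∁ A)
      ∁-member A thick = M-maximal λ {Bs} Bs∈M G →
        let x , h = thick G
            y , k = member⇒Satisfiable q (finite-meet q {P = λ g → - x +⁺ g +ˢ (∁ A ∩ ⋂ Bs)}
                      (All.map (λ {g} ∉q → meet q (shift-∁ (x +⁺ g) {A} ∉q) (shift-⋂ (x +⁺ g) Bs∈M)) h))
        in x +⁺ y , All.map (λ {g} → subst (∁ A ∩ ⋂ Bs) (xy+z≡xz+y x g y)) k

    minimal⇒uniformlyRecurrent : ∀ {p} → IsMinimalIdempotent p → UniformlyRecurrent p
    minimal⇒uniformlyRecurrent p-min =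
      IsSmallestIdeal.least K-smallest UniformlyRecurrent
        (uniformlyRecurrent-isIdeal uniformlyRecurrent-exists) p∈K
      where open IsMinimalIdempotent p-min

  -- Bounded gaps over ℤ, and requirements on the next term.

  module MillikenTaylor {p : βℕ} (idem : p +β p ≈β p) (ur : UniformlyRecurrent p)
                        {A : Pred ℕ⁺ 0ℓ} (A∈p : A ∈ members p) where

    open Equivalence

    -- Large (a₀ ∷ … ∷ aₖ ∷ []) m says that A ∈ m + a₀p + ⋯ + aₖp.
    Large : List ℤ → Pred ℤ 0ℓ
    Large []       m = inℤ A m
    Large (c ∷ cs) m = (λ x → Large cs (m ℤ.+ c ℤ.* toℤ x)) ∈ members p

    -- Adding a positive number raises the bound by one, and `p = p + p` brings the sum back to `p`.
    tail-member : ∀ N → (λ x → N ℕ.< value x) ∈ members p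
    tail-member ℕ.zero = upward p (λ { {x , Irr.[ nz ]} _ → ℕ.>-nonZero⁻¹ x {{nz}} }) (universe p)
    tail-member (suc N) = to (idem _) (upward p
      (λ N<x → upward p (ℕ.+-mono-≤ (ℕ.≤-trans (ℕ.s≤s ℕ.z≤n) N<x)) (tail-member N)) (tail-member N))

    positive-shift : ∀ m y → ℤ.∣ m ∣ ℕ.< value y → ∃ λ w → m ℤ.+ toℤ y ≡ toℤ w
    positive-shift (+ n) (y , _) n<y =
      (n ℕ.+ y , Irr.[ ℕ.>-nonZero (ℕ.<-≤-trans (ℕ.≤-<-trans ℕ.z≤n n<y) (ℕ.m≤n+m y n)) ]) , refl
    positive-shift -[1+ n ] (y , _) n<y =
      (y ℕ.∸ suc n , Irr.[ ℕ.>-nonZero (ℕ.m<n⇒0<n∸m n<y) ]) , ℤ.⊖-≥ (ℕ.<⇒≤ n<y)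

    Large-bounded : List ℤ → Set
    Large-bounded cs = ∃ λ G → ∀ m → Any (λ g → Large cs (m ℤ.+ toℤ g)) G

    -- Since `p`-almost every `y` exceeds `∣ m ∣`, recurrence applies to the positive number `m + y`
    -- even for negative `m`. Pigeonholing over `y` fixes `g`, and `p + p = p` merges `y` with the
    -- last term.
    Large-bounded-1 : Large-bounded (1ℤ ∷ [])
    Large-bounded-1 = G , λ m → Any.map (to (idem _)) (pigeonhole p G
      (upward p (λ {y} N<y → largeAt m y (positive-shift m y N<y)) (tail-member ℤ.∣ m ∣)))
      where
      G = proj₁ (ur A A∈p)

      rearrange : ∀ m g y z → ((m ℤ.+ y) ℤ.+ g) ℤ.+ z ≡ (m ℤ.+ g) ℤ.+ 1ℤ ℤ.* (y ℤ.+ z)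
      rearrange = ℤ-solve-∀

      largeAt : ∀ m y → ∃ (λ w → m ℤ.+ toℤ y ≡ toℤ w) →
        Any (λ g → - y +ˢ (λ x → inℤ A ((m ℤ.+ toℤ g) ℤ.+ 1ℤ ℤ.* toℤ x)) ∈ members p) G
      largeAt m y (w , m+y≡w) = Any.map (λ {g} → upward p λ {z} ∈A → (w +⁺ g) +⁺ z , ∈A ,
        trans (sym (rearrange m (toℤ g) (toℤ y) (toℤ z)))
              (cong (λ v → (v ℤ.+ toℤ g) ℤ.+ toℤ z) m+y≡w)) (proj₂ (ur A A∈p) w)

    -- The shift suited to `m + c x` varies with `x` inside the same finite `G`; the pigeonhole
    -- principle in `p` fixes one.
    Large-bounded-∷ : ∀ c cs → Large-bounded cs → Large-bounded (c ∷ cs)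
    Large-bounded-∷ c cs (G , h) = G , λ m → pigeonhole p G (upward p
      (λ {x} _ → Any.map (λ {g} → subst (Large cs) (xy∙z≈xz∙y-ℤ m (c ℤ.* toℤ x) (toℤ g)))
                         (h (m ℤ.+ c ℤ.* toℤ x))) (universe p))

    Large-bounded-tabulate : ∀ k (a : Fin (suc k) → ℤ) → a (fromℕ k) ≡ 1ℤ →
                             Large-bounded (List.tabulate a)
    Large-bounded-tabulate ℕ.zero  a a≡1 =
      subst (λ c → Large-bounded (c ∷ [])) (sym a≡1) Large-bounded-1
    Large-bounded-tabulate (suc k) a a≡1 =
      Large-bounded-∷ (a Fin.zero) (List.tabulate (a ∘ Fin.suc))
        (Large-bounded-tabulate k (a ∘ Fin.suc) a≡1)

    -- Coefficients still to be realised, with the partial sum so far, translate included. The head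
    -- belongs to the block in progress or about to begin.
    Requirement : Set
    Requirement = List ℤ × ℤ

    Valid : Pred Requirement 0ℓ
    Valid (cs , m) = Large cs m

    -- The term x may be the last of the current block or be followed by further terms of it.
    continue : ℕ⁺ → Requirement → List Requirement
    continue x ([]     , m) = []
    continue x (c ∷ cs , m) = (cs , m ℤ.+ c ℤ.* toℤ x) ∷ (c ∷ cs , m ℤ.+ c ℤ.* toℤ x) ∷ []

    -- Closing the block uses `v` itself; prolonging it uses `v` read through `p = p + p`, with
    -- `x + y` in place of one term.
    continue-valid : ∀ {r} → Valid r → (λ x → All Valid (continue x r)) ∈ members p
    continue-valid {[] , m}     _ = upward p (λ _ → []) (universe p)
    continue-valid {c ∷ cs , m} v = upward p
      (λ {x} (now , later) →
        now ∷ upward p (λ {y} → subst (Large cs) (distrib m c (toℤ x) (toℤ y))) later ∷ [])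
      (meet p v (from (idem _) v))

    -- Inductive choice of the sequence.

    module Construction (start : ℕ → List Requirement) (start-valid : ∀ n → All Valid (start n)) where

      choose : ∀ {T} → All Valid T → ∃ λ x → All (λ r → All Valid (continue x r)) T
      choose v = member⇒Satisfiable p (finite-meet p (All.map (λ {r} → continue-valid {r}) v))

      state : ℕ → ∃ (All Valid)
      state ℕ.zero  = start 0 , start-valid 0
      state (suc n) = let T , v = state n ; x , v′ = choose v in
        -- Keeping `T` lets blocks skip `x n`. System `suc n` enters only now, so each stage carries
        -- finitely many requirements.
        start (suc n) ++ (T ++ List.concatMap (continue x) T) ,
        All.++⁺ (start-valid (suc n)) (All.++⁺ v (All.concat⁺ (All.map⁺ v′)))

      T : ℕ → List Requirement
      T = proj₁ ∘ state

      x : ℕ → ℕ⁺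
      x n = proj₁ (choose (proj₂ (state n)))

      start⊆T : ∀ n → start n ⊆ˡ T n
      start⊆T ℕ.zero  = id
      start⊆T (suc n) = ∈-++⁺ˡ

      T-mono : ∀ {n N} → n ℕ.≤′ N → T n ⊆ˡ T N
      T-mono (ℕ.≤′-reflexive refl) r∈ = r∈
      T-mono {N = suc N} (ℕ.≤′-step n≤N) r∈ =
        ∈-++⁺ʳ (start (suc N)) (∈-++⁺ˡ (T-mono n≤N r∈))

      continue⊆T : ∀ {n r} → r ∈ˡ T n → continue (x n) r ⊆ˡ T (suc n)
      continue⊆T {n} r∈ s∈ = ∈-++⁺ʳ (start (suc n)) (∈-++⁺ʳ (T n)
        (∈-concatMap⁺ (continue (x n)) (Any.map (λ { refl → s∈ }) r∈)))

      -- Monotonicity of `T` carries a requirement past skipped indices; the second entry of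
      -- `continue` prolongs the block, the first closes it.
      block : ∀ {n N c cs m} t ts → (c ∷ cs , m) ∈ˡ T n →
        n ℕ.≤ t → AllPairs ℕ._<_ (t ∷ ts) → All (ℕ._< N) (t ∷ ts) →
        (cs , m ℤ.+ c ℤ.* List.foldr ℤ._+_ 0ℤ (List.map (toℤ ∘ x) (t ∷ ts))) ∈ˡ T N
      block {n} {N} {c} {cs} {m} t [] r∈ n≤t _ (t<N ∷ []) =
        subst (λ v → (cs , m ℤ.+ c ℤ.* v) ∈ˡ T N) (sym (ℤ.+-identityʳ (toℤ (x t))))
          (T-mono (ℕ.≤⇒≤′ t<N) (continue⊆T (T-mono (ℕ.≤⇒≤′ n≤t) r∈) (here refl)))
      block {n} {N} {c} {cs} {m} t (u ∷ us) r∈ n≤t ((t<u ∷ _) ∷ inc) (_ ∷ <N) =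
        subst (λ v → (cs , v) ∈ˡ T N) (sym (distrib m c (toℤ (x t)) _))
          (block u us (continue⊆T (T-mono (ℕ.≤⇒≤′ n≤t) r∈) (there (here refl))) t<u inc <N)

      -- The term `x t` leads from `T t` to `T (suc t)`, so the block is complete one stage past its
      -- maximum.
      block-𝒫f : ∀ {n c cs m} F → (c ∷ cs , m) ∈ˡ T n → All (n ℕ.≤_) (toList (elements F)) →
        (cs , m ℤ.+ c ℤ.* ∑∈ F (toℤ ∘ x)) ∈ˡ T (suc (max𝒫f F))
      block-𝒫f record { elements = t ∷ ts ; increasing = inc } r∈ (n≤t ∷ _) =
        block t ts r∈ n≤t inc (ℕ.s≤s (⊥≤max t ts) ∷ All.map ℕ.s≤s (xs≤max t ts))

      <𝒫f⇒All< : ∀ F G → F <𝒫f G → All (max𝒫f F ℕ.<_) (toList (elements G))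
      <𝒫f⇒All< F record { elements = t ∷ ts } F<G =
        ℕ.<-≤-trans F<G (min≤⊤ t ts) ∷ All.map (ℕ.<-≤-trans F<G) (min≤xs t ts)

      blocks : ∀ {n m} k (a : Fin (suc k) → ℤ) (F : Fin (suc k) → 𝒫f) →
        (List.tabulate a , m) ∈ˡ T n → All (n ℕ.≤_) (toList (elements (F Fin.zero))) →
        (∀ j → F (Fin.inject₁ j) <𝒫f F (Fin.suc j)) →
        ∃ λ N → ([] , m ℤ.+ sum +-0-monoid (λ j → a j ℤ.* ∑∈ (F j) (toℤ ∘ x))) ∈ˡ T N
      blocks {m = m} ℕ.zero a F r∈ n≤F _ = suc (max𝒫f (F Fin.zero)) ,
        subst (λ v → ([] , m ℤ.+ v) ∈ˡ T (suc (max𝒫f (F Fin.zero)))) (sym (ℤ.+-identityʳ _))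
          (block-𝒫f (F Fin.zero) r∈ n≤F)
      blocks {m = m} (suc k) a F r∈ n≤F F< =
        -- The closing stage of the first block is exactly the lower bound that `F< Fin.zero` gives
        -- for the next.
        let N , h = blocks k (a ∘ Fin.suc) (F ∘ Fin.suc) (block-𝒫f (F Fin.zero) r∈ n≤F)
                      (<𝒫f⇒All< (F Fin.zero) (F (Fin.suc Fin.zero)) (F< Fin.zero)) (F< ∘ Fin.suc)
        in N , subst (λ v → ([] , v) ∈ˡ T N) (ℤ.+-assoc m _ _) h

      fulfilled : ∀ N {z} → ([] , z) ∈ˡ T N → inℤ A z
      fulfilled N = All.lookup (proj₂ (state N))

theorem6p3 : (∀ {ℓ} → ExcludedMiddle ℓ) →
    (∀ {ℓ ℓ′} → Extensionality ℓ ℓ′) →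
    (k : ℕ → ℕ⁺) (a : ∀ i → Fin (suc (value (k i))) → ℤ) →
    (∀ i → Compressed (a i)) →
    (∀ i → a i (fromℕ (value (k i))) ≡ 1ℤ) →
    (p : βℕ) → IsMinimalIdempotent p →
    (A : Pred ℕ⁺ 0ℓ) → A ∈ members p →
    ∃ λ (b : ℕ → ℕ⁺) → ∃ λ (x : ℕ → ℕ⁺) →
    (FS x ⊆ inℤ A) × (∀ i → (b i +ᵗ MT (a i) i x) ⊆ inℤ A)
theorem6p3 em ext k a _ a≡1 p p-min A A∈p = proj₁ ∘ translate , x , FS⊆A , MT⊆A
  where
  open MillikenTaylor em {p} (IsMinimalIdempotent.idempotent p-min)
    (minimal⇒uniformlyRecurrent em ext p-min) {A} A∈p

  translate : ∀ i → ∃ λ b → Large (List.tabulate (a i)) (toℤ b)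
  translate i = let G , h = Large-bounded-tabulate (value (k i)) (a i) (a≡1 i) in
    -- At `m = 0` the covering shift is itself a positive integer and serves as `b i`.
    Any.satisfied (h 0ℤ)

  -- The first entry yields `FS`; its base is `0ℤ` because `A` itself lies in `p`.
  start : ℕ → List Requirement
  start i = (1ℤ ∷ [] , 0ℤ) ∷ (List.tabulate (a i) , toℤ (proj₁ (translate i))) ∷ []

  start-valid : ∀ i → All Valid (start i)
  start-valid i =
      upward p (λ {x} x∈A → x , x∈A , trans (ℤ.+-identityˡ _) (ℤ.*-identityˡ (toℤ x))) A∈p
    ∷ proj₂ (translate i) ∷ []

  open Construction start start-valid

  FS⊆A : FS x ⊆ inℤ A
  FS⊆A (F , refl) = subst (inℤ A) (trans (ℤ.+-identityˡ _) (ℤ.*-identityˡ _))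
    (fulfilled (suc (max𝒫f F)) (block-𝒫f F (start⊆T 0 (here refl)) (All.universal (λ _ → ℕ.z≤n) _)))

  MT⊆A : ∀ i → (proj₁ (translate i) +ᵗ MT (a i) i x) ⊆ inℤ A
  MT⊆A i (_ , (F , i≤F , F< , refl) , refl) =
    let N , h = blocks (value (k i)) (a i) F (start⊆T i (there (here refl))) (i≤F Fin.zero) F<
    in fulfilled N h
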